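{- The upper bound $O(n^2\sigma)$ on the number of minimal absent words of an unrooted tree is realized. Namely, for all integers $s,N\ge 1$, the unrooted tree $T_{s,N}$ defined in the context, which has $n=(s+1)N+s(N+1)+1$ nodes and edges labeled by the alphabet $\Sigma=\{0,1,\ldots,s\}$ of size $\sigma=s+1$, has $\Omega(s^3N^2)=\Omega(n^{2}\sigma)$ minimal absent words; i.e., there is an absolute constant $c>0$ such that $|\mathrm{MAW}(T_{s,N})|\ge c\,n^2\sigma$ for all $s,N\ge 1$.
   Context: Let $T$ be an unrooted tree (a finite connected acyclic undirected graph) whose edges are labeled by letters of a finite alphabet $\Sigma$. The language $L(T)$ is the set of all words obtained by concatenating the edge labels along a simple path of $T$, read from one endpoint to the other (in either direction; the empty path gives the empty word). A word $aub$ with $a,b\in\Sigma$ and $u$ a (possibly empty) word over $\Sigma$ is a minimal absent word of $T$ if $aub\notin L(T)$ while $au\in L(T)$ and $ub\in L(T)$. The set of minimal absent words of $T$ is $\mathrm{MAW}(T)$. The tree $T_{s,N}$ is defined as follows. Take a path of $N+1$ nodes $x_1,x_2,\ldots,x_{N+1}$ with every edge $x_ix_{i+1}$ labeled $0$. To each of $x_1,\ldots,x_N$ attach $s$ leaves, by edges labeled $1,2,\ldots,s$ respectively. For each $i\in\{1,\ldots,s\}$, take a path of $N+1$ new nodes $y_{i,0},y_{i,1},\ldots,y_{i,N}$ with all edges $y_{i,j}y_{i,j+1}$ labeled $0$, and join $x_{N+1}$ to $y_{i,0}$ by an edge labeled $i$. -}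

module Defs where

open import Data.Fin using (Fin; zero; suc; inject₁; fromℕ)
open import Data.Integer using (+_)
open import Data.List using (List; []; _∷_; _∷ʳ_; length)
open import Data.List.Membership.Propositional using (_∈_)
open import Data.List.Relation.Unary.Unique.Propositional using (Unique)
open import Data.Nat using (ℕ; suc; _≤_)
open import Data.Product using (Σ-syntax; ∃-syntax; _×_)
open import Data.Rational using (ℚ; _/_)
open import Function.Bundles using (_⇔_; _↔_)
open import Relation.Binary.Construct.Closure.Symmetric using (SymClosure)
open import Relation.Binary.PropositionalEquality using (_≡_)
open import Relation.Nullary using (¬_)

record LabelledGraph (A : Set) : Set₁ where
  field
    Vertex : Set
    Edge   : Vertex → A → Vertex → Set

module _ {A : Set} (G : LabelledGraph A) where
  open LabelledGraph G

  data Walk : Vertex → List A → Vertex → Set where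
    []  : ∀ {u} → Walk u [] u
    _∷_ : ∀ {u v t a w} → Edge u a v → Walk v w t → Walk u (a ∷ w) t

module _ {A : Set} {G : LabelledGraph A} where
  open LabelledGraph G

  vertices : ∀ {u w v} → Walk G u w v → List Vertex
  vertices {u} []      = u ∷ []
  vertices {u} (_ ∷ p) = u ∷ vertices p

  Simple : ∀ {u w v} → Walk G u w v → Set
  Simple p = Unique (vertices p)

-- A cycle is a simple path on at least three vertices (hence with at least two
-- edges) together with an edge joining its last vertex to its first one.
record IsUnrootedTree {A : Set} (G : LabelledGraph A) : Set where
  open LabelledGraph G
  field
    finite      : ∃[ n ] (Fin n ↔ Vertex)
    symmetric   : ∀ {u a v} → Edge u a v → Edge v a u
    loopless    : ∀ {u a} → ¬ Edge u a u
    uniqueLabel : ∀ {u a b v} → Edge u a v → Edge u b v → a ≡ b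
    connected   : ∀ u v → ∃[ w ] Walk G u w v
    acyclic     : ∀ {u w v a} (p : Walk G u w v) → Simple p → 2 ≤ length w →
                  ¬ Edge v a u

-- Membership in L(G). Both reading directions of a path are covered, since the
-- endpoints u and v are arbitrary and edges are symmetric.
Language : {A : Set} → LabelledGraph A → List A → Set
Language G w = ∃[ u ] ∃[ v ] Σ[ p ∈ Walk G u w v ] Simple p

MAW : {A : Set} → LabelledGraph A → List A → Set
MAW G w = ∃[ a ] ∃[ u ] ∃[ b ]
  (w ≡ a ∷ (u ∷ʳ b) × ¬ Language G w × Language G (a ∷ u) × Language G (u ∷ʳ b))

-- Cardinality of the set { x ∣ P x }, as the length of a repetition-free
-- complete listing, so that different proofs of P x are not counted twice.
HasCardinality : {B : Set} → (B → Set) → ℕ → Set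
HasCardinality {B} P m =
  Σ[ xs ∈ List B ] (Unique xs × (∀ x → x ∈ xs ⇔ P x) × length xs ≡ m)

-- Indices in Fin are counted from zero:
--   x i       is the node x_{i+1},
--   leaf i k  is the leaf attached to x_{i+1} by the edge labelled k+1,
--   y k j     is the node y_{k+1,j}.
data Node (s N : ℕ) : Set where
  x    : Fin (suc N) → Node s N
  leaf : Fin N → Fin s → Node s N
  y    : Fin s → Fin (suc N) → Node s N

-- Each edge with one orientation; the letter k of {0,…,s} is k : Fin (suc s).
data Arc {s N : ℕ} : Node s N → Fin (suc s) → Node s N → Set where
  spine  : ∀ i   → Arc (x (inject₁ i)) zero (x (suc i))
  twig   : ∀ i k → Arc (x (inject₁ i)) (suc k) (leaf i k)
  join   : ∀ k   → Arc (x (fromℕ N)) (suc k) (y k zero)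
  branch : ∀ k j → Arc (y k (inject₁ j)) zero (y k (suc j))

T : (s N : ℕ) → LabelledGraph (Fin (suc s))
T s N = record
  { Vertex = Node s N
  ; Edge   = λ u a v → SymClosure (λ u′ v′ → Arc u′ a v′) u v
  }

fromNat : ℕ → ℚ
fromNat n = + n / 1

{-# OPTIONS --safe #-}
module Submission where

-- For i, j, k ≥ 1 and 1 ≤ p, q ≤ N the word i 0ᵖ j 0^q k is minimal absent. It is absent
-- because an edge with a non-zero label that is not at the end of the path is one of the
-- edges x_{N+1} y_{j,0}, and behind it there are only zeros. Its prefix is read from a leaf
-- along the spine into branch j, its suffix from branch j back along the spine to a leaf.
-- This gives s³N² minimal absent words, while n ≤ 5sN and σ ≤ 2s yield n²σ ≤ 50 s³N².
-- The cardinality itself exists because L(T) is decidable and its words have length < n.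

open import Defs
open import Data.Fin using (Fin; zero; suc; inject₁; fromℕ; toℕ)
open import Data.Fin.Induction using (<-weakInduction)
open import Data.Fin.Properties
  using (any?; injective⇒≤; toℕ-inject₁; toℕ-fromℕ; toℕ-injective; toℕ≤pred[n]; +↔⊎; *↔×)
  renaming (_≟_ to _≟ᶠ_)
import Data.Integer as ℤ
import Data.Integer.Properties as ℤ
open import Data.List
  using (List; []; _∷_; _∷ʳ_; [_]; _++_; length; lookup; replicate; reverse; filter;
         deduplicate; allFin; cartesianProductWith; initLast; _∷ʳ′_)
open import Data.List.Membership.Propositional using (_∈_)
open import Data.List.Membership.Propositional.Properties
  using (∈-lookup; ∈-filter⁺; ∈-filter⁻; ∈-deduplicate⁺; ∈-deduplicate⁻;
         ∈-cartesianProductWith⁺; ∈-allFin)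
open import Data.List.Properties
  using (≡-dec; ∷-injective; ∷ʳ-injective; ++-assoc; reverse-++; unfold-reverse)
open import Data.List.Relation.Binary.Permutation.Propositional using (↭-sym; ↭⇒↭ₛ)
open import Data.List.Relation.Binary.Permutation.Propositional.Properties using (↭-reverse)
open import Data.List.Relation.Binary.Permutation.Setoid.Properties using (Unique-resp-↭)
open import Data.List.Relation.Unary.All as All using (All; []; _∷_)
open import Data.List.Relation.Unary.AllPairs using ([]; _∷_)
open import Data.List.Relation.Unary.Any using (here; there; index)
open import Data.List.Relation.Unary.Any.Properties using (lookup-index)
open import Data.List.Relation.Unary.Unique.Propositional using (Unique)
import Data.List.Relation.Unary.Unique.DecPropositional as DecUnique
open import Data.List.Relation.Unary.Unique.DecPropositional.Properties using (deduplicate-!)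
open import Data.Nat using (ℕ; zero; suc; _+_; _*_; _^_; _≤_; _<_; z≤n; s≤s; s≤s⁻¹)
open import Data.Nat.Properties
  using (≤-refl; ≤-trans; ≤-reflexive; <⇒≤; ≤⇒≯; <-irrefl; <-asym; <-trans; ≤-<-trans;
         suc-injective; +-identityʳ; +-suc; *-comm; m≤m+n; +-mono-≤; +-monoʳ-<;
         *-mono-≤; *-monoʳ-≤; ^-monoˡ-≤; module ≤-Reasoning)
open import Data.Nat.Solver using (module +-*-Solver)
open import Data.Product using (∃-syntax; Σ-syntax; _×_; _,_; proj₁; proj₂)
open import Data.Product.Function.NonDependent.Propositional using (_×-↔_)
open import Data.Product.Properties using () renaming (≡-dec to ×-≡-dec)
open import Data.Rational as ℚ using (ℚ; 0ℚ)
import Data.Rational.Properties as ℚ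
import Data.Rational.Unnormalised as ℚᵘ
import Data.Rational.Unnormalised.Properties as ℚᵘ
open import Data.Sum using (_⊎_; inj₁; inj₂)
open import Data.Sum.Function.Propositional using (_⊎-↔_)
open import Function using (_∘_)
open import Function.Bundles using (_↔_; Inverse; mk↔ₛ′; mk⇔; Equivalence; Injection)
open import Function.Construct.Composition using (_↔-∘_)
open import Function.Construct.Identity using (↔-id)
open import Function.Construct.Symmetry using (↔-sym)
open import Function.Definitions using (Injective)
open import Function.Properties.Inverse using (↔⇒↣)
open import Relation.Binary using (DecidableEquality)
open import Relation.Binary.Construct.Closure.Symmetric using (SymClosure; fwd; bwd)
import Relation.Binary.Construct.Closure.Symmetric as SymClosure
open import Relation.Binary.PropositionalEquality
  using (_≡_; refl; sym; trans; cong; cong₂; subst; setoid; module ≡-Reasoning)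
open import Relation.Nullary using (¬_; Dec; no; contradiction; ¬?)
open import Relation.Nullary.Decidable using (map′; via-injection; _×-dec_; _⊎-dec_)
open import Relation.Unary using (Decidable)

-- Finite sets and cardinalities

lookup-injective : ∀ {A : Set} {xs : List A} → Unique xs → Injective _≡_ _≡_ (lookup xs)
lookup-injective (_ ∷ _)   {zero}  {zero}  _  = refl
lookup-injective (px ∷ _)  {zero}  {suc j} eq = contradiction eq (All.lookup px (∈-lookup j))
lookup-injective (px ∷ _)  {suc i} {zero}  eq = contradiction (sym eq) (All.lookup px (∈-lookup i))
lookup-injective (_ ∷ pxs) {suc i} {suc j} eq = cong suc (lookup-injective pxs eq)

module _ {n : ℕ} {V : Set} (V↔ : Fin n ↔ V) where
  open Inverse V↔

  unique⇒length≤ : ∀ {xs : List V} → Unique xs → length xs ≤ n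
  unique⇒length≤ u =
    injective⇒≤ (lookup-injective u ∘ Injection.injective (↔⇒↣ (↔-sym V↔)))

  finite⇒≟ : DecidableEquality V
  finite⇒≟ = via-injection (↔⇒↣ (↔-sym V↔)) _≟ᶠ_

  finite⇒any? : ∀ {P : V → Set} → Decidable P → Dec (∃[ v ] P v)
  finite⇒any? {P} P? = map′ (λ (i , p) → to i , p)
    (λ (v , p) → from v , subst P (sym (strictlyInverseˡ v)) p)
    (any? (λ i → P? (to i)))

module _ {B : Set} {P : B → Set} where

  -- Any finite list of candidates that contains all solutions will do: filtering makes it exact,
  -- and deduplication then makes its length the cardinality.
  hasCardinality : DecidableEquality B → Decidable P → (xs : List B) →
                   (∀ {b} → P b → b ∈ xs) → ∃[ m ] HasCardinality P m
  hasCardinality _≟_ P? xs complete = _ , ys , deduplicate-! _≟_ _ , (λ b → mk⇔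
      (λ b∈ → proj₂ (∈-filter⁻ P? {xs = xs} (∈-deduplicate⁻ _≟_ (filter P? xs) b∈)))
      (λ Pb → ∈-deduplicate⁺ _≟_ (∈-filter⁺ P? (complete Pb) Pb)))
    , refl
    where ys = deduplicate _≟_ (filter P? xs)

  -- Sending `i` to the position of `f i` in the listing is injective, because the element can be
  -- recovered from its position.
  hasCardinality-≥ : ∀ {m k} → HasCardinality P m → (f : Fin k → B) →
                     Injective _≡_ _≡_ f → (∀ i → P (f i)) → k ≤ m
  hasCardinality-≥ {k = k} (xs , _ , iff , refl) f f-inj Pf = injective⇒≤ index-injective
    where
    f∈ : ∀ i → f i ∈ xs
    f∈ i = Equivalence.from (iff (f i)) (Pf i)

    index-injective : Injective _≡_ _≡_ (λ i → index (f∈ i))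
    index-injective {i} {j} eq = f-inj
      (trans (lookup-index (f∈ i)) (trans (cong (lookup xs) eq) (sym (lookup-index (f∈ j)))))

words≤ : ∀ k → ℕ → List (List (Fin k))
words≤ k zero    = [ [] ]
words≤ k (suc m) = [] ∷ cartesianProductWith _∷_ (allFin k) (words≤ k m)

words≤-complete : ∀ {k} m (w : List (Fin k)) → length w ≤ m → w ∈ words≤ k m
words≤-complete zero    []      _       = here refl
words≤-complete (suc m) []      _       = here refl
words≤-complete (suc m) (a ∷ w) (s≤s l) =
  there (∈-cartesianProductWith⁺ _∷_ (∈-allFin a) (words≤-complete m w l))

-- Walks and languages of labelled graphs

module _ {A : Set} {G : LabelledGraph A} where
  open LabelledGraph G

  length-vertices : ∀ {u w v} (p : Walk G u w v) → length (vertices p) ≡ suc (length w)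
  length-vertices []      = refl
  length-vertices (_ ∷ p) = cong suc (length-vertices p)

  source∈vertices : ∀ {u w v} (p : Walk G u w v) → u ∈ vertices p
  source∈vertices []      = here refl
  source∈vertices (_ ∷ _) = here refl

  target∈vertices : ∀ {u w v} (p : Walk G u w v) → v ∈ vertices p
  target∈vertices []      = here refl
  target∈vertices (_ ∷ p) = there (target∈vertices p)

  append : ∀ {u w₁ v w₂ t} → Walk G u w₁ v → Walk G v w₂ t → Walk G u (w₁ ++ w₂) t
  append []      q = q
  append (e ∷ p) q = e ∷ append p q

  vertices-snoc : ∀ {u w v a t} (p : Walk G u w v) (e : Edge v a t) →
                  vertices (append p (e ∷ [])) ≡ vertices p ∷ʳ t
  vertices-snoc         []      e = refl
  vertices-snoc {u = u} (_ ∷ p) e = cong (u ∷_) (vertices-snoc p e)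

  -- Absence of a word is shown by exhibiting a repeated vertex, either inside the second part or
  -- between that part and a vertex preceding the whole walk. The two extra components serve these
  -- two cases.
  split : ∀ w₁ {w₂ u v} (p : Walk G u (w₁ ++ w₂) v) →
          ∃[ t ] (Walk G u w₁ t × (Σ[ q ∈ Walk G t w₂ v ]
            ((Simple p → Simple q) × (∀ {z} → z ∈ vertices q → z ∈ vertices p))))
  split []       p       = _ , [] , p , (λ s → s) , (λ z∈ → z∈)
  split (a ∷ w₁) (e ∷ p) with split w₁ p
  ... | t , p₁ , q , simple , ⊆ = t , e ∷ p₁ , q , (λ { (_ ∷ s) → simple s }) , there ∘ ⊆

  reverse-walk : (∀ {u a v} → Edge u a v → Edge v a u) → ∀ {u w v} (p : Walk G u w v) →
                 Σ[ q ∈ Walk G v (reverse w) u ] vertices q ≡ reverse (vertices p)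
  reverse-walk symm []                              = [] , refl
  reverse-walk symm {u} {w = a ∷ w} (e ∷ p) with reverse-walk symm p
  ... | q , eq rewrite unfold-reverse a w | unfold-reverse u (vertices p) =
    append q (symm e ∷ []) , trans (vertices-snoc q (symm e)) (cong (_∷ʳ u) eq)

  language-reverse : (∀ {u a v} → Edge u a v → Edge v a u) → ∀ {w} →
                     Language G w → Language G (reverse w)
  language-reverse symm (u , v , p , simple) with reverse-walk symm p
  ... | q , eq = v , u , q , subst Unique (sym eq)
    (Unique-resp-↭ (setoid Vertex) (↭⇒↭ₛ (↭-sym (↭-reverse (vertices p)))) simple)

module _ {A : Set} (G : LabelledGraph A) {n : ℕ} (V↔ : Fin n ↔ LabelledGraph.Vertex G) where
  open LabelledGraph G

  language⇒length< : ∀ {w} → Language G w → length w < n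
  language⇒length< (_ , _ , p , simple) =
    subst (_≤ n) (length-vertices p) (unique⇒length≤ V↔ simple)

  module _ (edge? : ∀ u a v → Dec (Edge u a v)) where

    -- Simplicity concerns the whole vertex list and is not inherited step by step. With an
    -- arbitrary predicate `P` the recursion can carry the vertices already visited inside the
    -- predicate.
    walk? : ∀ {P : List Vertex → Set} → Decidable P → ∀ u w →
            Dec (∃[ v ] Σ[ p ∈ Walk G u w v ] P (vertices p))
    walk? P? u []      = map′ (λ q → u , [] , q) (λ { (_ , [] , q) → q }) (P? (u ∷ []))
    walk? P? u (a ∷ w) = map′
      (λ (_ , e , v , p , q) → v , e ∷ p , q)
      (λ { (v , e ∷ p , q) → _ , e , v , p , q })
      (finite⇒any? V↔ (λ t → edge? u a t ×-dec walk? (λ vs → P? (u ∷ vs)) t w))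

    language? : Decidable (Language G)
    language? w = finite⇒any? V↔ (λ u → walk? (DecUnique.unique? (finite⇒≟ V↔)) u w)

    -- A word with at least two letters has exactly one factorisation `a u b`, so the existential
    -- reduces to three membership tests; shorter words have none.
    maw? : Decidable (MAW G)
    maw? [] = no λ ()
    maw? (a ∷ w) with initLast w
    ... | []      = no λ { (_ , [] , _ , () , _) ; (_ , _ ∷ _ , _ , () , _) }
    ... | u ∷ʳ′ b = map′
      (λ h → a , u , b , refl , h)
      (λ { (a′ , u′ , b′ , eq , h) → cast (∷-injective eq) h })
      (¬? (language? (a ∷ (u ∷ʳ b))) ×-dec language? (a ∷ u) ×-dec language? (u ∷ʳ b))
      where
      cast : ∀ {a′ u′ b′} → a ≡ a′ × u ∷ʳ b ≡ u′ ∷ʳ b′ →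
             ¬ Language G (a ∷ (u ∷ʳ b)) × Language G (a′ ∷ u′) × Language G (u′ ∷ʳ b′) →
             ¬ Language G (a ∷ (u ∷ʳ b)) × Language G (a ∷ u) × Language G (u ∷ʳ b)
      cast {u′ = u′} (refl , eq) h with refl , refl ← ∷ʳ-injective u u′ eq = h

  -- The word has one letter more than `ub`, which is read along a simple path. The bound is not
  -- tight; it only has to make the search space finite.
  maw⇒length≤ : ∀ {w} → MAW G w → length w ≤ suc n
  maw⇒length≤ (a , u , b , refl , _ , _ , ub) = s≤s (<⇒≤ (language⇒length< ub))

maw-hasCardinality : ∀ {k n} (G : LabelledGraph (Fin k)) → Fin n ↔ LabelledGraph.Vertex G →
                     (∀ u a v → Dec (LabelledGraph.Edge G u a v)) →
                     ∃[ m ] HasCardinality (MAW G) m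
maw-hasCardinality {n = n} G V↔ edge? = hasCardinality (≡-dec _≟ᶠ_) (maw? G V↔ edge?)
  (words≤ _ (suc n)) (λ {w} h → words≤-complete (suc n) w (maw⇒length≤ G V↔ h))

-- Trees given by arcs directed away from a root

module _ {A V : Set} (_⟶[_]_ : V → A → V → Set) (depth : V → ℕ)
         (arc-depth : ∀ {u a v} → u ⟶[ a ] v → depth v ≡ suc (depth u))
         (arc-source : ∀ {u a u′ a′ v} → u ⟶[ a ] v → u′ ⟶[ a′ ] v → u ≡ u′ × a ≡ a′) where

  -- For the arcs `Arc` this unfolds to `T s N`, so `rooted-tree` applies to it without transport.
  -- `arc-source` says that a vertex has at most one parent, reached by one label.
  undirected : LabelledGraph A
  undirected = record { Vertex = V ; Edge = λ u a v → SymClosure (λ u′ v′ → u′ ⟶[ a ] v′) u v }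

  private
    arc-< : ∀ {u a v} → u ⟶[ a ] v → depth u < depth v
    arc-< e = ≤-reflexive (sym (arc-depth e))

  -- In a rooted tree a simple path which has once gone down can never go up again.
  simple-descends : ∀ {u a v w t} (e : u ⟶[ a ] v) (p : Walk undirected v w t) →
                    Simple (_∷_ {G = undirected} (fwd e) p) → depth u < depth t
  simple-descends e []          _ = arc-< e
  simple-descends e (fwd f ∷ p) (_ ∷ s) = <-trans (arc-< e) (simple-descends f p s)
  simple-descends e (bwd f ∷ p) (u∉ ∷ _) with refl , _ ← arc-source e f =
    contradiction refl (All.lookup u∉ (there (source∈vertices p)))

  -- The last edge enters `v` either from its parent `u` or from a child of `v`. In the second case
  -- the path cannot have gone down before, so it climbs all the way and starts below `v`.
  simple-to-child : ∀ {u a v t b w} → u ⟶[ a ] v → (p : Walk undirected t (b ∷ w) v) →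
                    Simple p → u ∈ vertices p ⊎ depth v < depth t
  simple-to-child uv (fwd e ∷ []) _ with refl , _ ← arc-source uv e = inj₁ (here refl)
  simple-to-child uv (bwd e ∷ []) _ = inj₂ (arc-< e)
  simple-to-child uv (e ∷ p@(_ ∷ _)) s@(_ ∷ s′) with simple-to-child uv p s′
  ... | inj₁ u∈ = inj₁ (there u∈)
  simple-to-child uv (bwd e ∷ p@(_ ∷ _)) s | inj₂ lt = inj₂ (<-trans lt (arc-< e))
  -- After a first step down, `v` would be deeper than the start `t`; but `v` is less deep than the
  -- child of `t` that follows, hence at most as deep as `t`.
  simple-to-child uv (fwd e ∷ p@(_ ∷ _)) s | inj₂ lt =
    contradiction (simple-descends e p s) (≤⇒≯ (s≤s⁻¹ (≤-trans lt (≤-reflexive (arc-depth e)))))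

  rooted-tree : ∀ {n r} → Fin n ↔ V → (∀ v → ∃[ w ] Walk undirected r w v) →
                IsUnrootedTree undirected
  rooted-tree {n} V↔ reach = record
    { finite      = n , V↔
    ; symmetric   = symm
    ; loopless    = λ { (fwd e) → <-irrefl refl (arc-< e) ; (bwd e) → <-irrefl refl (arc-< e) }
    ; uniqueLabel = λ
      { (fwd e) (fwd f) → proj₂ (arc-source e f)
      ; (bwd e) (bwd f) → proj₂ (arc-source e f)
      ; (fwd e) (bwd f) → contradiction (arc-< e) (<-asym (arc-< f))
      ; (bwd e) (fwd f) → contradiction (arc-< e) (<-asym (arc-< f)) }
    ; connected   = λ u v → _ ,
        append (proj₁ (reverse-walk symm (proj₂ (reach u)))) (proj₂ (reach v))
    ; acyclic     = acyclic
    }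
    where
    symm : ∀ {u a v} → SymClosure (λ u′ v′ → u′ ⟶[ a ] v′) u v →
           SymClosure (λ u′ v′ → u′ ⟶[ a ] v′) v u
    symm = SymClosure.symmetric _

    -- If `v` is the parent of `u`, a path starting downwards ends too deep, and one starting
    -- upwards meets `v` at once and again at its end. If `u` is the parent of `v`, the path without
    -- its first edge either returns to `u` or starts deeper than `v`, which no neighbour of `u` is.
    acyclic : ∀ {u w v a} (p : Walk undirected u w v) → Simple p → 2 ≤ length w →
              ¬ SymClosure (λ u′ v′ → u′ ⟶[ a ] v′) v u
    acyclic (_ ∷ []) _ (s≤s ())
    acyclic (fwd e ∷ p) s _ (fwd vu) = <-asym (arc-< vu) (simple-descends e p s)
    acyclic (bwd e ∷ _ ∷ q) (_ ∷ (v∉ ∷ _)) _ (fwd vu) with refl , _ ← arc-source vu e =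
      All.lookup v∉ (target∈vertices q) refl
    acyclic (e ∷ p@(_ ∷ _)) (u∉ ∷ s) _ (bwd uv) with simple-to-child uv p s
    ... | inj₁ u∈ = All.lookup u∉ u∈ refl
    acyclic (bwd e ∷ _ ∷ _) _ _ (bwd uv) | inj₂ lt =
      <-asym (arc-< uv) (<-trans lt (arc-< e))
    acyclic (fwd e ∷ _ ∷ _) _ _ (bwd uv) | inj₂ lt =
      <-irrefl (trans (arc-depth uv) (sym (arc-depth e))) lt

-- The tree T s N

module _ {s N : ℕ} where

  node-enum : Fin (suc N + (N * s + s * suc N)) ↔ Node s N
  node-enum = nodes ↔-∘ ((↔-id _ ⊎-↔ (*↔× ⊎-↔ *↔×)) ↔-∘ ((↔-id _ ⊎-↔ +↔⊎) ↔-∘ +↔⊎))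
    where
    nodes : (Fin (suc N) ⊎ (Fin N × Fin s ⊎ Fin s × Fin (suc N))) ↔ Node s N
    nodes = mk↔ₛ′
      (λ { (inj₁ i) → x i ; (inj₂ (inj₁ (i , k))) → leaf i k ; (inj₂ (inj₂ (k , j))) → y k j })
      (λ { (x i) → inj₁ i ; (leaf i k) → inj₂ (inj₁ (i , k)) ; (y k j) → inj₂ (inj₂ (k , j)) })
      (λ { (x _) → refl ; (leaf _ _) → refl ; (y _ _) → refl })
      (λ { (inj₁ _) → refl ; (inj₂ (inj₁ _)) → refl ; (inj₂ (inj₂ _)) → refl })

  arc? : ∀ (u : Node s N) a v → Dec (Arc u a v)
  arc? u a v = map′
    (λ { (inj₁ (i , refl)) → spine i
       ; (inj₂ (inj₁ (i , k , refl))) → twig i k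
       ; (inj₂ (inj₂ (inj₁ (k , refl)))) → join k
       ; (inj₂ (inj₂ (inj₂ (k , j , refl)))) → branch k j })
    (λ { (spine i) → inj₁ (i , refl)
       ; (twig i k) → inj₂ (inj₁ (i , k , refl))
       ; (join k) → inj₂ (inj₂ (inj₁ (k , refl)))
       ; (branch k j) → inj₂ (inj₂ (inj₂ (k , j , refl))) })
    ( any? (λ i → is (x (inject₁ i) , zero , x (suc i)))
    ⊎-dec any? (λ i → any? (λ k → is (x (inject₁ i) , suc k , leaf i k)))
    ⊎-dec any? (λ k → is (x (fromℕ N) , suc k , y k zero))
    ⊎-dec any? (λ k → any? (λ j → is (y k (inject₁ j) , zero , y k (suc j)))))
    where
    _≟ⁿ_ : DecidableEquality (Node s N)
    _≟ⁿ_ = finite⇒≟ node-enum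

    is : (e : Node s N × Fin (suc s) × Node s N) → Dec (e ≡ (u , a , v))
    is e = ×-≡-dec _≟ⁿ_ (×-≡-dec _≟ᶠ_ _≟ⁿ_) e (u , a , v)

  edge? : ∀ u a v → Dec (LabelledGraph.Edge (T s N) u a v)
  edge? u a v = map′
    (λ { (inj₁ e) → fwd e ; (inj₂ e) → bwd e })
    (λ { (fwd e) → inj₁ e ; (bwd e) → inj₂ e })
    (arc? u a v ⊎-dec arc? v a u)

  -- The distance from the root `x zero`.
  depth : Node s N → ℕ
  depth (x i)      = toℕ i
  depth (leaf i _) = suc (toℕ i)
  depth (y _ j)    = suc N + toℕ j

  arc-depth : ∀ {u : Node s N} {a v} → Arc u a v → depth v ≡ suc (depth u)
  arc-depth (spine i)    = cong suc (sym (toℕ-inject₁ i))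
  arc-depth (twig i _)   = cong suc (sym (toℕ-inject₁ i))
  arc-depth (join _)     = cong suc (trans (+-identityʳ N) (sym (toℕ-fromℕ N)))
  arc-depth (branch _ j) = cong suc (trans (+-suc N (toℕ j))
    (cong (λ m → suc (N + m)) (sym (toℕ-inject₁ j))))

  arc-source : ∀ {u : Node s N} {a u′ a′ v} → Arc u a v → Arc u′ a′ v → u ≡ u′ × a ≡ a′
  arc-source (spine _)    (spine _)    = refl , refl
  arc-source (twig _ _)   (twig _ _)   = refl , refl
  arc-source (join _)     (join _)     = refl , refl
  arc-source (branch _ _) (branch _ _) = refl , refl

  reach : ∀ (v : Node s N) → ∃[ w ] Walk (T s N) (x zero) w v
  reach (x i)      = <-weakInduction (λ i → ∃[ w ] Walk (T s N) (x zero) w (x i)) (_ , [])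
    (λ i (_ , p) → _ , append p (fwd (spine i) ∷ [])) i
  reach (leaf i k) = _ , append (proj₂ (reach (x (inject₁ i)))) (fwd (twig i k) ∷ [])
  reach (y k j)    = <-weakInduction (λ j → ∃[ w ] Walk (T s N) (x zero) w (y k j))
    (_ , append (proj₂ (reach (x (fromℕ N)))) (fwd (join k) ∷ []))
    (λ j (_ , p) → _ , append p (fwd (branch k j) ∷ [])) j

  T-isUnrootedTree : IsUnrootedTree (T s N)
  T-isUnrootedTree = rooted-tree Arc depth arc-depth arc-source node-enum reach

-- Minimal absent words of the form i 0ᵖ j 0^q k

zeros : ∀ {s} → ℕ → List (Fin (suc s))
zeros n = replicate n zero

zeros-∷ʳ : ∀ {s} n → zeros {s} n ∷ʳ zero ≡ zeros (suc n)
zeros-∷ʳ zero    = refl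
zeros-∷ʳ (suc n) = cong (zero ∷_) (zeros-∷ʳ n)

reverse-zeros : ∀ {s} n → reverse (zeros {s} n) ≡ zeros n
reverse-zeros zero        = refl
reverse-zeros {s} (suc n) = trans (unfold-reverse zero (zeros n))
  (trans (cong (_∷ʳ zero) (reverse-zeros n)) (zeros-∷ʳ n))

zeros-injective : ∀ {s} m n {j k : Fin s} {v w} →
                  zeros m ++ suc j ∷ v ≡ zeros n ++ suc k ∷ w → m ≡ n × j ≡ k × v ≡ w
zeros-injective zero    zero    refl = refl , refl , refl
zeros-injective (suc m) (suc n) eq with zeros-injective m n (proj₂ (∷-injective eq))
... | refl , refl , refl = refl , refl , refl

module _ {s : ℕ} where

  tailWord : ℕ → Fin s → ℕ → Fin s → List (Fin (suc s))
  tailWord p j q k = zeros p ++ suc j ∷ (zeros q ++ [ suc k ])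

  word : Fin s → ℕ → Fin s → ℕ → Fin s → List (Fin (suc s))
  word i p j q k = suc i ∷ tailWord p j q k

  word-injective : ∀ {i p j q k i′ p′ j′ q′ k′} → word i p j q k ≡ word i′ p′ j′ q′ k′ →
                   i ≡ i′ × p ≡ p′ × j ≡ j′ × q ≡ q′ × k ≡ k′
  word-injective {p = p} {q = q} {p′ = p′} {q′ = q′} eq with ∷-injective eq
  ... | refl , eq₁ with zeros-injective p p′ eq₁
  ... | p≡ , j≡ , eq₂ with zeros-injective q q′ eq₂
  ... | q≡ , k≡ , _ = refl , p≡ , j≡ , q≡ , k≡

  tailWord-∷ʳ : ∀ p j q k → (zeros p ++ suc j ∷ zeros q) ∷ʳ suc k ≡ tailWord p j q k
  tailWord-∷ʳ p j q k = ++-assoc (zeros p) (suc j ∷ zeros q) [ suc k ]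

  -- Reversal turns the suffix shape into the prefix shape, so one family of explicit paths settles
  -- both membership conditions of a minimal absent word.
  reverse-tailWord : ∀ p j q k →
                     reverse (tailWord p j q k) ≡ suc k ∷ (zeros q ++ suc j ∷ zeros p)
  reverse-tailWord p j q k = begin
    reverse (zeros p ++ suc j ∷ (zeros q ++ [ suc k ]))
      ≡⟨ reverse-++ (zeros p) _ ⟩
    reverse (suc j ∷ (zeros q ++ [ suc k ])) ++ reverse (zeros p)
      ≡⟨ cong₂ _++_ (unfold-reverse (suc j) (zeros q ++ [ suc k ])) (reverse-zeros p) ⟩
    (reverse (zeros q ++ [ suc k ]) ∷ʳ suc j) ++ zeros p
      ≡⟨ cong (λ w → (w ∷ʳ suc j) ++ zeros p) (reverse-++ (zeros q) [ suc k ]) ⟩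
    suc k ∷ ((reverse (zeros q) ∷ʳ suc j) ++ zeros p)
      ≡⟨ cong (λ w → suc k ∷ ((w ∷ʳ suc j) ++ zeros p)) (reverse-zeros q) ⟩
    suc k ∷ ((zeros q ∷ʳ suc j) ++ zeros p)
      ≡⟨ cong (suc k ∷_) (++-assoc (zeros q) [ suc j ] (zeros p)) ⟩
    suc k ∷ (zeros q ++ suc j ∷ zeros p) ∎
    where open ≡-Reasoning

-- An element of `Fin N` forces `N` to be positive, so the last spine node has a predecessor; that
-- one has index `N - 1`, the largest value `toℕ q` can take.
fromℕ-suc : ∀ {N} (q : Fin N) → ∃[ i ] (fromℕ N ≡ suc i × toℕ q ≤ toℕ i)
fromℕ-suc {suc N} q = fromℕ N , refl ,
  ≤-trans (toℕ≤pred[n] q) (≤-reflexive (sym (toℕ-fromℕ N)))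

module _ {s N : ℕ} where

  -- Strictly decreasing along the path that runs down a branch to x_{N+1},
  -- back along the spine and out into a leaf.
  rank : Node s N → ℕ
  rank (leaf _ _) = 0
  rank (x i)      = suc (toℕ i)
  rank (y _ j)    = suc (suc N) + toℕ j

  -- Strict decrease of `rank` is a condition on single edges, so such walks can be assembled piece
  -- by piece without comparing distant vertices.
  data Descent (u : Node s N) : List (Fin (suc s)) → Set where
    []  : Descent u []
    _∷_ : ∀ {a v w} → LabelledGraph.Edge (T s N) u a v × rank v < rank u →
          Descent v w → Descent u (a ∷ w)

  -- The rank bound is the invariant that yields simplicity: every later vertex has smaller rank
  -- than `u`, hence differs from it.
  descent⇒walk : ∀ {u w} → Descent u w → ∃[ v ] Σ[ p ∈ Walk (T s N) u w v ]
                 (Simple p × All (λ t → rank t ≤ rank u) (vertices p))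
  descent⇒walk []            = _ , [] , [] ∷ [] , ≤-refl ∷ []
  descent⇒walk ((e , lt) ∷ d) with descent⇒walk d
  ... | v , p , simple , below = v , e ∷ p ,
    All.map (λ { le refl → <-irrefl refl (≤-<-trans le lt) }) below ∷ simple ,
    ≤-refl ∷ All.map (λ le → ≤-trans le (<⇒≤ lt)) below

  descent⇒language : ∀ {u w} → Descent u w → Language (T s N) w
  descent⇒language d with v , p , simple , _ ← descent⇒walk d = _ , v , p , simple

  -- There are `toℕ i` spine edges before this node, enough for `q` zeros. The start has the form
  -- `inject₁ i` because exactly these spine nodes carry twigs.
  spine-descent : ∀ (i : Fin N) q k → q ≤ toℕ i →
                  Descent (x (inject₁ i)) (zeros q ++ [ suc k ])
  spine-descent i       zero    k _        = (fwd (twig i k) , s≤s z≤n) ∷ []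
  spine-descent (suc i) (suc q) k (s≤s le) =
    (bwd (spine (inject₁ i)) , s≤s (≤-reflexive (cong suc (toℕ-inject₁ (inject₁ i)))))
    ∷ spine-descent (inject₁ i) q k (≤-trans le (≤-reflexive (sym (toℕ-inject₁ i))))

  -- The junction itself has no twig, so at least one zero comes before the leaf; this is why the
  -- runs have lengths from 1 to `N`.
  junction-descent : ∀ (q : Fin N) k → Descent (x (fromℕ N)) (zeros (suc (toℕ q)) ++ [ suc k ])
  junction-descent q k with fromℕ-suc q
  ... | i , eq , q≤i rewrite eq =
    (bwd (spine i) , s≤s (≤-reflexive (cong suc (toℕ-inject₁ i))))
    ∷ spine-descent i (toℕ q) k q≤i

  branch-descent : ∀ j {w} → Descent (x (fromℕ N)) w → ∀ p →
                   Descent (y j p) (zeros (toℕ p) ++ suc j ∷ w)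
  branch-descent j {w} d = <-weakInduction (λ p → Descent (y j p) (zeros (toℕ p) ++ suc j ∷ w))
    -- The ranks on the two sides of the joining edge are `N + 2` and `N + 1`.
    ((bwd (join j) , s≤s (s≤s (≤-trans (≤-reflexive (toℕ-fromℕ N)) (m≤m+n N 0)))) ∷ d)
    step
    where
    step : ∀ p → Descent (y j (inject₁ p)) (zeros (toℕ (inject₁ p)) ++ suc j ∷ w) →
           Descent (y j (suc p)) (zeros (suc (toℕ p)) ++ suc j ∷ w)
    step p d′ = (bwd (branch j p) , s≤s (s≤s (+-monoʳ-< N (s≤s (≤-reflexive (toℕ-inject₁ p))))))
      ∷ subst (λ m → Descent (y j (inject₁ p)) (zeros m ++ suc j ∷ w)) (toℕ-inject₁ p) d′

  tailWord∈language : ∀ (p : Fin (suc N)) j (q : Fin N) k →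
                      Language (T s N) (tailWord (toℕ p) j (suc (toℕ q)) k)
  tailWord∈language p j q k = descent⇒language (branch-descent j (junction-descent q k) p)

  headWord∈language : ∀ i (p : Fin N) j (q : Fin (suc N)) →
                      Language (T s N) (suc i ∷ (zeros (suc (toℕ p)) ++ suc j ∷ zeros (toℕ q)))
  headWord∈language i p j q = subst (Language (T s N)) (reverse-tailWord (toℕ q) j (suc (toℕ p)) i)
    (language-reverse (SymClosure.symmetric _) (tailWord∈language q j p i))

  -- The only edge leaving a branch is its joining edge, whose label is non-zero.
  zeros-from-branch : ∀ q {k j v} → Walk (T s N) (y k j) (zeros q) v → ∃[ j′ ] v ≡ y k j′
  zeros-from-branch zero    []                   = _ , refl
  zeros-from-branch (suc q) (fwd (branch _ _) ∷ p) = zeros-from-branch q p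
  zeros-from-branch (suc q) (bwd (branch _ _) ∷ p) = zeros-from-branch q p

  zeros-to-branch : ∀ q {u k j} → Walk (T s N) u (zeros q) (y k j) → ∃[ j′ ] u ≡ y k j′
  zeros-to-branch zero    []      = _ , refl
  zeros-to-branch (suc q) (e ∷ p) with zeros-to-branch q p
  zeros-to-branch (suc q) (fwd (branch _ _) ∷ p) | _ , refl = _ , refl
  zeros-to-branch (suc q) (bwd (branch _ _) ∷ p) | _ , refl = _ , refl

  zeros-from-leaf : ∀ q {i k w v} → ¬ Walk (T s N) (leaf i k) (zeros (suc q) ++ w) v
  zeros-from-leaf q (fwd () ∷ _)
  zeros-from-leaf q (bwd () ∷ _)

  zeros-to-leaf : ∀ q {u i k} → ¬ Walk (T s N) u (zeros (suc q)) (leaf i k)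
  zeros-to-leaf zero    (fwd () ∷ [])
  zeros-to-leaf zero    (bwd () ∷ [])
  zeros-to-leaf (suc q) (_ ∷ p) = zeros-to-leaf q p

  -- The letter j can only be read on an edge x_{N+1} y_{j,0}, as twigs end in leaves;
  -- reading a non-zero letter beyond the branch then means crossing this edge again.
  word∉language : ∀ i p j q k → ¬ Language (T s N) (word i (suc p) j (suc q) k)
  word∉language i p j q k (_ , _ , e ∷ r , u∉ ∷ simple)
    with split (zeros (suc p)) r
  ... | _ , r₁ , fwd (twig _ _) ∷ r₂ , _ , _ = zeros-from-leaf q r₂
  ... | _ , r₁ , bwd (twig _ _) ∷ r₂ , _ , _ = zeros-to-leaf p r₁
  ... | _ , r₁ , fwd (join _) ∷ r₂ , simple₂ , _ with simple₂ simple | split (zeros (suc q)) r₂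
  ...   | c∉ ∷ _ | _ , t₁ , f ∷ [] , _ , _ with zeros-from-branch (suc q) t₁
  word∉language i p j q k (_ , _ , e ∷ r , u∉ ∷ simple)
      | _ , r₁ , fwd (join _) ∷ r₂ , simple₂ , _
        | c∉ ∷ _ | _ , t₁ , bwd (join _) ∷ [] , _ , _ | _ , refl =
    All.lookup c∉ (target∈vertices r₂) refl
  word∉language i p j q k (_ , _ , e ∷ r , u∉ ∷ simple)
      | _ , r₁ , bwd (join _) ∷ r₂ , _ , ⊆ with zeros-to-branch (suc p) r₁
  word∉language i p j q k (_ , _ , fwd (join _) ∷ r , u∉ ∷ simple)
      | _ , r₁ , bwd (join _) ∷ r₂ , _ , ⊆ | _ , refl =
    All.lookup u∉ (⊆ (there (source∈vertices r₂))) refl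

  word∈MAW : ∀ i (p : Fin N) j (q : Fin N) k →
             MAW (T s N) (word i (suc (toℕ p)) j (suc (toℕ q)) k)
  word∈MAW i p j q k =
    suc i , zeros (suc (toℕ p)) ++ suc j ∷ zeros (suc (toℕ q)) , suc k ,
    cong (suc i ∷_) (sym eq) ,
    word∉language i (toℕ p) j (toℕ q) k ,
    -- In the prefix the second run lies inside the branch, which has `N` zero edges, so the length
    -- `toℕ (suc q)` fits even when it equals `N`.
    headWord∈language i p j (suc q) ,
    subst (Language (T s N)) (sym eq) (tailWord∈language (suc p) j q k)
    where eq = tailWord-∷ʳ (suc (toℕ p)) j (suc (toℕ q)) k

  maws≥ : ∀ {m} → HasCardinality (MAW (T s N)) m → s * (s * (s * (N * N))) ≤ m
  maws≥ card = hasCardinality-≥ card (λ c → maw (to c)) (to-injective ∘ maw-injective)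
      (λ c → let i , j , k , p , q = to c in word∈MAW i p j q k)
    where
    code : Fin (s * (s * (s * (N * N)))) ↔ (Fin s × Fin s × Fin s × Fin N × Fin N)
    code = (↔-id _ ×-↔ ((↔-id _ ×-↔ ((↔-id _ ×-↔ *↔×) ↔-∘ *↔×)) ↔-∘ *↔×)) ↔-∘ *↔×

    open Inverse code using (to)
    open Injection (↔⇒↣ code) using () renaming (injective to to-injective)

    maw : Fin s × Fin s × Fin s × Fin N × Fin N → List (Fin (suc s))
    maw (i , j , k , p , q) = word i (suc (toℕ p)) j (suc (toℕ q)) k

    maw-injective : ∀ {c d} → maw c ≡ maw d → c ≡ d
    maw-injective {i , j , k , p , q} {i′ , j′ , k′ , p′ , q′} eq
      with word-injective {j = j} {k = k} {j′ = j′} {k′ = k′} eq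
    ... | refl , p≡ , refl , q≡ , refl
      with refl ← toℕ-injective {i = p} {j = p′} (suc-injective p≡)
         | refl ← toℕ-injective {i = q} {j = q′} (suc-injective q≡) = refl

-- Arithmetic

module _ (s N : ℕ) (1≤s : 1 ≤ s) (1≤N : 1 ≤ N) where
  private
    n = (s + 1) * N + s * (N + 1) + 1
    σ = s + 1

    n≤ : n ≤ 5 * (s * N)
    n≤ = begin
      (s + 1) * N + s * (N + 1) + 1
        -- Each 1 is raised to `s`, `N` or `s * N`, so the three summands contribute 2, 2 and 1
        -- times `s * N`.
        ≤⟨ +-mono-≤ (+-mono-≤ (*-mono-≤ (+-mono-≤ (≤-refl {s}) 1≤s) (≤-refl {N}))
                              (*-mono-≤ (≤-refl {s}) (+-mono-≤ (≤-refl {N}) 1≤N)))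
                    (*-mono-≤ 1≤s 1≤N) ⟩
      (s + s) * N + s * (N + N) + s * N
        ≡⟨ solve 2 (λ s N → (s :+ s) :* N :+ s :* (N :+ N) :+ s :* N := con 5 :* (s :* N)) refl s N ⟩
      5 * (s * N) ∎
      where open ≤-Reasoning
            open +-*-Solver

  n²σ≤50s³N² : n ^ 2 * σ ≤ 50 * (s * (s * (s * (N * N))))
  n²σ≤50s³N² = begin
    n ^ 2 * σ                     ≤⟨ *-mono-≤ (^-monoˡ-≤ 2 n≤) (+-mono-≤ (≤-refl {s}) 1≤s) ⟩
    (5 * (s * N)) ^ 2 * (s + s)
      ≡⟨ solve 2 (λ s N → (con 5 :* (s :* N)) :^ 2 :* (s :+ s)
                       := con 50 :* (s :* (s :* (s :* (N :* N))))) refl s N ⟩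
    50 * (s * (s * (s * (N * N)))) ∎
    where open ≤-Reasoning
          open +-*-Solver

s³N²-product : ∀ s N → s ^ 3 * N ^ 2 ≡ s * (s * (s * (N * N)))
s³N²-product = solve 2 (λ s N → s :^ 3 :* N :^ 2 := s :* (s :* (s :* (N :* N)))) refl
  where open +-*-Solver

node-count : ∀ s N → suc N + (N * s + s * suc N) ≡ (s + 1) * N + s * (N + 1) + 1
node-count = solve 2 (λ s N → con 1 :+ N :+ (N :* s :+ s :* (con 1 :+ N))
                           := (s :+ con 1) :* N :+ s :* (N :+ con 1) :+ con 1) refl
  where open +-*-Solver

toℚᵘ-fromNat : ∀ k → ℚ.toℚᵘ (fromNat k) ℚᵘ.≃ ℚᵘ.mkℚᵘ (ℤ.+ k) 0
toℚᵘ-fromNat k = ℚ.toℚᵘ-fromℚᵘ (ℚᵘ.mkℚᵘ (ℤ.+ k) 0)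

1/50 : ℚ
1/50 = ℤ.+ 1 ℚ./ 50

-- Among unnormalised rationals no gcd has to be computed, and the claim becomes the integer
-- inequality `cross` between cross products.
1/50*-≤ : ∀ k m → k ≤ 50 * m → 1/50 ℚ.* fromNat k ℚ.≤ fromNat m
1/50*-≤ k m k≤ = ℚ.toℚᵘ-cancel-≤ (begin
  ℚ.toℚᵘ (1/50 ℚ.* fromNat k)            ≃⟨ ℚ.toℚᵘ-homo-* 1/50 (fromNat k) ⟩
  ℚ.toℚᵘ 1/50 ℚᵘ.* ℚ.toℚᵘ (fromNat k)    ≃⟨ ℚᵘ.*-congˡ {ℚ.toℚᵘ 1/50} (toℚᵘ-fromNat k) ⟩
  ℚ.toℚᵘ 1/50 ℚᵘ.* ℚᵘ.mkℚᵘ (ℤ.+ k) 0     ≤⟨ ℚᵘ.*≤* cross ⟩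
  ℚᵘ.mkℚᵘ (ℤ.+ m) 0                      ≃⟨ toℚᵘ-fromNat m ⟨
  ℚ.toℚᵘ (fromNat m)                     ∎)
  where
  open ℚᵘ.≤-Reasoning

  cross : (ℤ.+ 1 ℤ.* ℤ.+ k) ℤ.* ℤ.+ 1 ℤ.≤ ℤ.+ m ℤ.* ℤ.+ 50
  cross rewrite ℤ.*-identityʳ (ℤ.+ 1 ℤ.* ℤ.+ k) | ℤ.*-identityˡ (ℤ.+ k) | sym (ℤ.pos-* m 50) =
    ℤ.+≤+ (≤-trans k≤ (≤-reflexive (*-comm 50 m)))

mainTheorem4 :
  ∃[ c ] (0ℚ ℚ.< c × (∀ (s N : ℕ) → 1 ≤ s → 1 ≤ N →
    let n = (s + 1) * N + s * (N + 1) + 1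
        σ = s + 1
    in IsUnrootedTree (T s N)
       × (Fin n ↔ LabelledGraph.Vertex (T s N))
       × (∃[ m ] (HasCardinality (MAW (T s N)) m
           × c ℚ.* fromNat (s ^ 3 * N ^ 2) ℚ.≤ fromNat m
           × c ℚ.* fromNat (n ^ 2 * σ) ℚ.≤ fromNat m))))
mainTheorem4 = 1/50 , ℚ.positive⁻¹ 1/50 , λ s N 1≤s 1≤N →
  let m , card = maw-hasCardinality (T s N) node-enum edge?
      m≥       = maws≥ card
  in T-isUnrootedTree
   , subst (λ k → Fin k ↔ Node s N) (node-count s N) node-enum
   , m , card
   -- Here `m` itself is already a bound; it is weakened to `50 * m`, which unfolds to `m + 49 * m`,
   -- so that one constant serves both estimates.
   , 1/50*-≤ _ m (≤-trans (≤-reflexive (s³N²-product s N)) (≤-trans m≥ (m≤m+n m (49 * m))))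
   , 1/50*-≤ _ m (≤-trans (n²σ≤50s³N² s N 1≤s 1≤N) (*-monoʳ-≤ 50 m≥))
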